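{- Let $(G_n)_{n\ge 0}$ be the sequence of graphs defined in the context. The dimension of the bicycle space of $G_n$ is $\frac{4^{n}-1}{3}$.
   Context: The graphs $G_n$: $G_0$ is the complete graph $K_2$ with its two vertices denoted $X_0,Y_0$. For $n\ge 0$, given $G_n$ with two special vertices $X_n,Y_n$, take four disjoint copies $G_n^1,G_n^2,G_n^3,G_n^4$ of $G_n$, with special vertices $X_n^i,Y_n^i$. Identify $X_n^1$ with $X_n^2$ to form the special vertex $X_{n+1}$ of $G_{n+1}$; identify $Y_n^3$ with $Y_n^4$ to form the special vertex $Y_{n+1}$ of $G_{n+1}$; identify $Y_n^1$ with $X_n^3$ to form a vertex $a$, and $Y_n^2$ with $X_n^4$ to form a vertex $b$; finally add a new edge $e_n$ joining $a$ and $b$. The result is $G_{n+1}$. Bicycle space: for a graph $G$, the bicycle space $\mathcal{B}$ of $G$ is the $\mathbb{F}_2$-subspace of $\mathbb{F}_2^{E(G)}$ given by the intersection of the cycle space of $G$ and the cut space (cocycle space) of $G$; its dimension is taken over $\mathbb{F}_2$. Fact recalled in the paper: $T(G;-1,-1)=(-1)^{|E(G)|}(-2)^{\dim\mathcal{B}}$, where $T(G;x,y)=\sum_{H\subseteq G}(x-1)^{r(G)-r(H)}(y-1)^{n(H)}$ is the Tutte polynomial (sum over spanning subgraphs $H$, with $r(H)=|V(H)|-k(H)$, $n(H)=|E(H)|-|V(H)|+k(H)$, and $k(H)$ the number of components of $H$). -}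

module Defs where

open import Algebra.Bundles using (CommutativeRing)
open import Data.Bool.Base using (Bool; false; true; _∧_; _xor_)
open import Data.Bool.Properties using (xor-∧-commutativeRing)
open import Data.Fin.Base using (Fin; zero; suc; combine; remQuot; _↑ʳ_)
open import Data.Fin.Patterns using (0F; 1F; 2F; 3F)
open import Data.Fin.Properties using (_≟_)
open import Data.Nat.Base using (ℕ; zero; suc; _+_; _*_)
open import Data.Product.Base using (∃; _×_; _,_; proj₁; proj₂; map)
open import Data.Vec.Functional using (Vector)
open import Relation.Binary.PropositionalEquality
  using (_≡_; _≗_; refl; sym; trans; cong₂)
open import Relation.Nullary.Decidable.Core using (does)

------------------------------------------------------------------------
-- Linear algebra over 𝔽₂

𝔽₂ : Set
𝔽₂ = Bool

module 𝔽₂-ring = CommutativeRing xor-∧-commutativeRing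

open import Algebra.Properties.Semiring.Sum 𝔽₂-ring.semiring public
  using (sum; sum-cong-≗; sum-replicate-zero; ∑-distrib-+)

private
  interchange : ∀ a b c d → (a xor b) xor (c xor d) ≡ (a xor c) xor (b xor d)
  interchange = +-interchange
    where
    open import Algebra.Properties.CommutativeSemigroup
      𝔽₂-ring.+-commutativeSemigroup using () renaming (interchange to +-interchange)

-- Vectors are functions, so a subspace must respect pointwise equality.
-- Closure under scalars follows from the fields, the scalars being 0 and 1.
record Subspace (m : ℕ) : Set₁ where
  field
    Member   : Vector 𝔽₂ m → Set
    respects : ∀ {v w} → v ≗ w → Member v → Member w
    0-closed : Member (λ _ → false)
    +-closed : ∀ {v w} → Member v → Member w → Member (λ e → v e xor w e)

infix 4 _∈_
_∈_ : ∀ {m} → Vector 𝔽₂ m → Subspace m → Set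
v ∈ W = Subspace.Member W v

infixr 7 _∩_
_∩_ : ∀ {m} → Subspace m → Subspace m → Subspace m
U ∩ W = record
  { Member   = λ v → v ∈ U × v ∈ W
  ; respects = λ v≗w → map (U.respects v≗w) (W.respects v≗w)
  ; 0-closed = U.0-closed , W.0-closed
  ; +-closed = λ (vU , vW) (wU , wW) → U.+-closed vU wU , W.+-closed vW wW
  }
  where
  module U = Subspace U
  module W = Subspace W

linearCombination : ∀ {m d} → Vector 𝔽₂ d → Vector (Vector 𝔽₂ m) d → Vector 𝔽₂ m
linearCombination c b e = sum (λ i → c i ∧ b i e)

record IsBasis {m d : ℕ} (W : Subspace m) (b : Vector (Vector 𝔽₂ m) d) : Set where
  field
    members     : ∀ i → b i ∈ W
    independent : ∀ c → linearCombination c b ≗ (λ _ → false) → c ≗ (λ _ → false)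
    spanning    : ∀ w → w ∈ W → ∃ λ c → w ≗ linearCombination c b

HasDimension : ∀ {m} → Subspace m → ℕ → Set
HasDimension {m} W d = ∃ λ (b : Vector (Vector 𝔽₂ m) d) → IsBasis W b

------------------------------------------------------------------------
-- Graphs and their bicycle spaces

-- The order of the two ends of an edge plays no role below.
record Graph : Set where
  field
    #V   : ℕ
    #E   : ℕ
    ends : Fin #E → Fin #V × Fin #V

module _ (G : Graph) where
  open Graph G

  incidence : Fin #V → Fin #E → 𝔽₂
  incidence v e = does (v ≟ proj₁ (ends e)) xor does (v ≟ proj₂ (ends e))

  degreeMod2 : Vector 𝔽₂ #E → Fin #V → 𝔽₂
  degreeMod2 w v = sum (λ e → w e ∧ incidence v e)

  -- The edge sets in which every vertex has even degree.
  cycleSpace : Subspace #E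
  cycleSpace = record
    { Member   = λ w → ∀ v → degreeMod2 w v ≡ false
    ; respects = λ w≗w′ even v → trans
        (sym (sum-cong-≗ (λ e → cong₂ _∧_ (w≗w′ e) refl))) (even v)
    ; 0-closed = λ _ → sum-replicate-zero #E
    ; +-closed = λ {w} {w′} even even′ v → trans
        (sum-cong-≗ (λ e → 𝔽₂-ring.distribʳ (incidence v e) (w e) (w′ e)))
        (trans (∑-distrib-+ (λ e → w e ∧ incidence v e) (λ e → w′ e ∧ incidence v e))
               (cong₂ _xor_ (even v) (even′ v)))
    }

  -- The set of edges with exactly one end in S.
  cut : Vector Bool #V → Vector 𝔽₂ #E
  cut S e = S (proj₁ (ends e)) xor S (proj₂ (ends e))

  cutSpace : Subspace #E
  cutSpace = record
    { Member   = λ w → ∃ λ S → w ≗ cut S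
    ; respects = λ w≗w′ (S , w≗cut) → S , λ e → trans (sym (w≗w′ e)) (w≗cut e)
    ; 0-closed = (λ _ → false) , λ _ → refl
    ; +-closed = λ (S , w≗cut) (S′ , w′≗cut) → (λ v → S v xor S′ v) , λ e → trans
        (cong₂ _xor_ (w≗cut e) (w′≗cut e))
        (interchange (S (proj₁ (ends e))) (S (proj₂ (ends e)))
                     (S′ (proj₁ (ends e))) (S′ (proj₂ (ends e))))
    }

  bicycleSpace : Subspace #E
  bicycleSpace = cycleSpace ∩ cutSpace

------------------------------------------------------------------------
-- The graphs Gₙ

-- A graph with two distinct special vertices: vertex 0 is X, vertex 1 is Y,
-- and the remaining vertices are numbered from 2.
record TwoTerminalGraph : Set where
  field
    #inner : ℕ
    #E     : ℕ
    ends   : Fin #E → Fin (2 + #inner) × Fin (2 + #inner)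

  graph : Graph
  graph = record { #V = 2 + #inner ; #E = #E ; ends = ends }

K₂ : TwoTerminalGraph
K₂ = record { #inner = 0 ; #E = 1 ; ends = λ _ → 0F , 1F }

-- The vertices of the glued graph are X, Y, a, b (numbered 0, 1, 2, 3) and
-- four disjoint copies of the inner vertices of H.  Since identifications only
-- involve special vertices, gluing amounts to saying where the X and Y of each
-- copy go; copies 1, 2, 3, 4 are indexed by 0F, 1F, 2F, 3F.
module _ {k : ℕ} where

  imageX imageY : Fin 4 → Fin (4 + 4 * k)
  imageX 0F = 0F
  imageX 1F = 0F
  imageX 2F = 2F
  imageX 3F = 3F
  imageY 0F = 2F
  imageY 1F = 3F
  imageY 2F = 1F
  imageY 3F = 1F

  place : Fin 4 → Fin (2 + k) → Fin (4 + 4 * k)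
  place i zero          = imageX i
  place i (suc zero)    = imageY i
  place i (suc (suc v)) = 4 ↑ʳ combine i v

glue : TwoTerminalGraph → TwoTerminalGraph
glue H = record
  { #inner = 2 + 4 * H.#inner
  ; #E     = 1 + 4 * H.#E
  ; ends   = λ where
      zero    → 2F , 3F
      (suc e) → let (i , e′) = remQuot H.#E e in map (place i) (place i) (H.ends e′)
  }
  where module H = TwoTerminalGraph H

twoTerminalG : ℕ → TwoTerminalGraph
twoTerminalG zero    = K₂
twoTerminalG (suc n) = glue (twoTerminalG n)

G : ℕ → Graph
G n = TwoTerminalGraph.graph (twoTerminalG n)

{-# OPTIONS --safe #-}

-- A bicycle is a cut w = cut S all of whose degrees are even, i.e. a potential S that is harmonic
-- mod 2.  Mod 2, each Gₙ behaves like a single edge of unit resistance: if S is harmonic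
-- at the inner vertices, then the current cut S flowing from X to Y is S X + S Y.  For Gₙ₊₁
-- this follows from the conservation laws at a and b, which both read
-- S X + S Y + S a + S b = 0.  With P the cut of a potential on Gₙ that is harmonic inside, 0 at X
-- and 1 at Y, the bicycles of Gₙ₊₁ are therefore exactly the vectors that vanish on eₙ and equal
-- x P + wᵢ on copy i, with a common scalar x and arbitrary bicycles wᵢ of Gₙ.  Since P is not
-- itself a bicycle, the dimensions satisfy dₙ₊₁ = 1 + 4 dₙ.

module Submission where

open import Defs
open import Algebra.Properties.Semiring.Sum 𝔽₂-ring.semiring
  using (∑-comm; *-distribˡ-sum; *-distribʳ-sum)
open import Data.Bool.Base using (false; true; _∧_; _xor_)
open import Data.Bool.Properties
  using (∧-assoc; ∧-comm; ∧-identityʳ; ∧-zeroʳ; ∧-distribʳ-xor; ∧-distribˡ-xor;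
         xor-assoc; xor-identityʳ; xor-same)
open import Data.Bool.Solver using (module xor-∧-Solver)
open import Data.Fin.Base using (Fin; zero; suc; combine; remQuot; _↑ˡ_; _↑ʳ_)
open import Data.Fin.Patterns using (0F; 1F; 2F; 3F)
open import Data.Fin.Properties using (_≟_; combine-remQuot; remQuot-combine)
open import Data.Nat.Base using (ℕ; zero; suc; _+_; _*_; _∸_; _^_)
open import Data.Nat.DivMod using (_/_; m*n/n≡m)
open import Data.Nat.Tactic.RingSolver using (solve-∀)
open import Data.Product.Base using (∃; _×_; _,_; proj₁; proj₂; uncurry)
open import Data.Vec.Functional using (Vector; []; _∷_)
open import Function.Base using (_∘_; const)
open import Relation.Binary.PropositionalEquality
  using (_≡_; _≗_; refl; sym; trans; cong; cong₂; subst; module ≡-Reasoning)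
open import Relation.Nullary.Decidable.Core using (does)

open ≡-Reasoning
open xor-∧-Solver using (solve; _:=_; _:+_; _:*_; con)

-- Finite sums over `𝔽₂`, and linear combinations inside a subspace.

sum-zero : ∀ {n} {f : Vector 𝔽₂ n} → f ≗ const false → sum f ≡ false
sum-zero {n} f≗0 = trans (sum-cong-≗ f≗0) (sum-replicate-zero n)

sum-indicator : ∀ {n} (f : Vector 𝔽₂ n) i → sum (λ j → f j ∧ does (j ≟ i)) ≡ f i
sum-indicator f zero = begin
  (f zero ∧ true) xor sum (λ j → f (suc j) ∧ false)
    ≡⟨ cong₂ _xor_ (∧-identityʳ (f zero)) (sum-zero (λ j → ∧-zeroʳ (f (suc j)))) ⟩
  f zero xor false
    ≡⟨ xor-identityʳ (f zero) ⟩
  f zero ∎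
sum-indicator f (suc i) =
  cong₂ _xor_ (∧-zeroʳ (f zero)) (sum-indicator (f ∘ suc) i)

sum-++ : ∀ m {n} (f : Vector 𝔽₂ (m + n)) →
         sum f ≡ sum (λ i → f (i ↑ˡ n)) xor sum (λ j → f (m ↑ʳ j))
sum-++ zero    f = refl
sum-++ (suc m) f =
  trans (cong (f zero xor_) (sum-++ m (f ∘ suc))) (sym (xor-assoc (f zero) _ _))

sum-combine : ∀ m {n} (f : Vector 𝔽₂ (m * n)) →
              sum f ≡ sum (λ i → sum (λ j → f (combine {m} i j)))
sum-combine zero        f = refl
sum-combine (suc m) {n} f =
  trans (sum-++ n f)
        (cong (sum (λ j → f (j ↑ˡ (m * n))) xor_) (sum-combine m {n} (λ j → f (n ↑ʳ j))))

linearCombination-∈ : ∀ {m d} (W : Subspace m) {b : Vector (Vector 𝔽₂ m) d} →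
                      (∀ i → b i ∈ W) → ∀ c → linearCombination c b ∈ W
linearCombination-∈ {d = zero}  W b∈W c = Subspace.0-closed W
linearCombination-∈ {d = suc d} W {b} b∈W c =
  W.+-closed (scaled (c zero)) (linearCombination-∈ W (b∈W ∘ suc) (c ∘ suc))
  where
  module W = Subspace W
  scaled : ∀ x → (λ e → x ∧ b zero e) ∈ W
  scaled false = W.0-closed
  scaled true  = b∈W zero

-- A record rather than a synonym: comparing bicycle spaces of equal graphs would otherwise
-- unfold the closure proofs of the subspaces, which is very slow.
record HasBicycleDimension (Γ : Graph) (d : ℕ) : Set where
  constructor mkHasBicycleDimension
  field
    hasDimension : HasDimension (bicycleSpace Γ) d

-- Orthogonality of the cycle space and the cut space.

module _ (Γ : Graph) where
  open Graph Γ

  -- The inner product of `w` with the coboundary of `T`. Exchanging sums turns it into the sum of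
  -- `T v` times the degree of `w` at `v`, so degree conditions become identities in a test function
  -- `T`.
  pairing : Vector 𝔽₂ #E → Vector 𝔽₂ #V → 𝔽₂
  pairing w T = sum (λ e → w e ∧ cut Γ T e)

  pairing-cong : ∀ {w w′ T T′} → w ≗ w′ → T ≗ T′ → pairing w T ≡ pairing w′ T′
  pairing-cong w≗w′ T≗T′ =
    sum-cong-≗ (λ e → cong₂ _∧_ (w≗w′ e) (cong₂ _xor_ (T≗T′ _) (T≗T′ _)))

  pairing-+ˡ : ∀ w w′ T →
    pairing (λ e → w e xor w′ e) T ≡ pairing w T xor pairing w′ T
  pairing-+ˡ w w′ T =
    trans (sum-cong-≗ (λ e → ∧-distribʳ-xor (cut Γ T e) (w e) (w′ e)))
          (∑-distrib-+ (λ e → w e ∧ cut Γ T e) (λ e → w′ e ∧ cut Γ T e))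

  pairing-∧ˡ : ∀ x w T → pairing (λ e → x ∧ w e) T ≡ x ∧ pairing w T
  pairing-∧ˡ x w T =
    trans (sum-cong-≗ (λ e → ∧-assoc x (w e) (cut Γ T e)))
          (sym (*-distribˡ-sum x (λ e → w e ∧ cut Γ T e)))

  pairing-∧ʳ : ∀ x w T → pairing w (λ v → T v ∧ x) ≡ pairing w T ∧ x
  pairing-∧ʳ x w T =
    trans (sum-cong-≗ (λ e → solve 4
      (λ x y t u → y :* ((t :* x) :+ (u :* x)) := x :* (y :* (t :+ u)))
      refl x (w e) (T (proj₁ (ends e))) (T (proj₂ (ends e)))))
    (trans (sym (*-distribˡ-sum x (λ e → w e ∧ cut Γ T e))) (∧-comm x _))

  -- Taking cuts is the transpose of the incidence map: the two indicators in the incidence row pick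
  -- out the values of `T` at the two ends.
  cut-as-sum : ∀ T e → cut Γ T e ≡ sum (λ v → T v ∧ incidence Γ v e)
  cut-as-sum T e with ends e
  ... | u , u′ = begin
    T u xor T u′
      ≡⟨ cong₂ _xor_ (sum-indicator T u) (sum-indicator T u′) ⟨
    sum (λ v → T v ∧ does (v ≟ u)) xor sum (λ v → T v ∧ does (v ≟ u′))
      ≡⟨ ∑-distrib-+ (λ v → T v ∧ does (v ≟ u)) (λ v → T v ∧ does (v ≟ u′)) ⟨
    sum (λ v → (T v ∧ does (v ≟ u)) xor (T v ∧ does (v ≟ u′)))
      ≡⟨ sum-cong-≗ (λ v → ∧-distribˡ-xor (T v) (does (v ≟ u)) (does (v ≟ u′))) ⟨
    sum (λ v → T v ∧ (does (v ≟ u) xor does (v ≟ u′))) ∎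

  cycle⊥cut : ∀ {w} → w ∈ cycleSpace Γ → ∀ T → pairing w T ≡ false
  cycle⊥cut {w} even T = begin
    sum (λ e → w e ∧ cut Γ T e)
      ≡⟨ sum-cong-≗ (λ e → cong (w e ∧_) (cut-as-sum T e)) ⟩
    sum (λ e → w e ∧ sum (λ v → T v ∧ incidence Γ v e))
      ≡⟨ sum-cong-≗ (λ e → *-distribˡ-sum (w e) (λ v → T v ∧ incidence Γ v e)) ⟩
    sum (λ e → sum (λ v → w e ∧ (T v ∧ incidence Γ v e)))
      -- Summing over edges first makes the degrees of `w` appear.
      ≡⟨ ∑-comm (λ e v → w e ∧ (T v ∧ incidence Γ v e)) ⟩
    sum (λ v → sum (λ e → w e ∧ (T v ∧ incidence Γ v e)))
      ≡⟨ sum-cong-≗ (λ v → sum-cong-≗ (λ e →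
           solve 3 (λ x y z → x :* (y :* z) := y :* (x :* z)) refl (w e) (T v) (incidence Γ v e))) ⟩
    sum (λ v → sum (λ e → T v ∧ (w e ∧ incidence Γ v e)))
      ≡⟨ sum-cong-≗ (λ v → *-distribˡ-sum (T v) (λ e → w e ∧ incidence Γ v e)) ⟨
    sum (λ v → T v ∧ degreeMod2 Γ w v)
      ≡⟨ sum-zero (λ v → trans (cong (T v ∧_) (even v)) (∧-zeroʳ (T v))) ⟩
    false ∎

  -- The cut of the indicator function of v is the row of the incidence matrix at v.
  ⊥cut⇒cycle : ∀ {w} → (∀ T → pairing w T ≡ false) → w ∈ cycleSpace Γ
  ⊥cut⇒cycle w⊥ v = w⊥ (λ u → does (v ≟ u))

-- Flows, harmonic potentials and unit resistors.

module _ (H : TwoTerminalGraph) where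
  open TwoTerminalGraph H

  -- Tested on indicator functions: w has degree 0 at inner vertices and degree s at X and at Y.
  record IsFlow (s : 𝔽₂) (w : Vector 𝔽₂ #E) : Set where
    constructor mkFlow
    field
      pairing≡ : ∀ T → pairing graph w T ≡ s ∧ (T 0F xor T 1F)

  -- Kirchhoff's law for the current `cut graph S` at the inner vertices: their indicators span the
  -- test functions that vanish at X and Y.
  record Harmonic (S : Vector 𝔽₂ (2 + #inner)) : Set where
    constructor mkHarmonic
    field
      pairing≡0 : ∀ T → T 0F ≡ false → T 1F ≡ false →
                  pairing graph (cut graph S) T ≡ false

  -- The invariant of the induction over `glue`: the current of a harmonic potential equals its
  -- voltage drop, and drop 1 is attained by `potential`, whose cut is the extra bicycle direction
  -- in the next graph.
  record IsUnitResistor : Set where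
    field
      harmonic⇒flow : ∀ S → Harmonic S → IsFlow (S 0F xor S 1F) (cut graph S)
      potential     : Vector 𝔽₂ (2 + #inner)
      potential-X   : potential 0F ≡ false
      potential-Y   : potential 1F ≡ true
      unitFlow      : IsFlow true (cut graph potential)

module _ {H : TwoTerminalGraph} where
  open TwoTerminalGraph H

  flow-cong : ∀ {s s′ w w′} → s ≡ s′ → w ≗ w′ → IsFlow H s w → IsFlow H s′ w′
  flow-cong s≡s′ w≗w′ (mkFlow eq) = mkFlow λ T →
    trans (pairing-cong graph {T = T} (λ e → sym (w≗w′ e)) (λ _ → refl))
          (trans (eq T) (cong (_∧ (T 0F xor T 1F)) s≡s′))

  flow-0 : IsFlow H false (λ _ → false)
  flow-0 = mkFlow λ _ → sum-replicate-zero #E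

  flow-+ : ∀ {s s′ w w′} → IsFlow H s w → IsFlow H s′ w′ →
           IsFlow H (s xor s′) (λ e → w e xor w′ e)
  flow-+ {s} {s′} {w} {w′} (mkFlow eq) (mkFlow eq′) = mkFlow λ T →
    trans (pairing-+ˡ graph w w′ T)
          (trans (cong₂ _xor_ (eq T) (eq′ T)) (sym (∧-distribʳ-xor (T 0F xor T 1F) s s′)))

  flow-∧ : ∀ x {s w} → IsFlow H s w → IsFlow H (x ∧ s) (λ e → x ∧ w e)
  flow-∧ x {s} {w} (mkFlow eq) = mkFlow λ T →
    trans (pairing-∧ˡ graph x w T) (trans (cong (x ∧_) (eq T)) (sym (∧-assoc x s (T 0F xor T 1F))))

  -- The strength is the degree at X, read off by pairing with the indicator of X.
  flow-unique : ∀ {s s′ w} → IsFlow H s w → IsFlow H s′ w → s ≡ s′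
  flow-unique {s} {s′} {w} (mkFlow eq) (mkFlow eq′) = begin
    s                  ≡⟨ ∧-identityʳ s ⟨
    s ∧ true           ≡⟨ eq δX ⟨
    pairing graph w δX ≡⟨ eq′ δX ⟩
    s′ ∧ true          ≡⟨ ∧-identityʳ s′ ⟩
    s′                 ∎
    where
    δX : Vector 𝔽₂ (2 + #inner)
    δX v = does (0F ≟ v)

  bicycle⇒flow : ∀ {w} → w ∈ bicycleSpace graph → IsFlow H false w
  bicycle⇒flow {w} (cycle , _) = mkFlow (cycle⊥cut graph {w} cycle)

  -- Adding a constant to the potential of a bicycle grounds both terminals.
  bicycle-grounded : IsUnitResistor H → ∀ {w} → w ∈ bicycleSpace graph →
    ∃ λ S → S 0F ≡ false × S 1F ≡ false × w ≗ cut graph S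
  bicycle-grounded R {w} w∈B@(_ , S , w≗cut) =
    (λ v → S v xor S 0F) , xor-same (S 0F) ,
    -- `S` agrees at X and Y: its cut is a flow of strength `S 0F xor S 1F` by the resistor law, and
    -- of strength zero as a bicycle.
    trans (solve 2 (λ x y → x :+ y := y :+ x) refl (S 1F) (S 0F))
          (flow-unique (IsUnitResistor.harmonic⇒flow R S S-harmonic) S-flow) ,
    λ e → trans (w≗cut e)
      (solve 3 (λ x y c → x :+ y := (x :+ c) :+ (y :+ c)) refl
        (S (proj₁ (ends e))) (S (proj₂ (ends e))) (S 0F))
    where
    S-flow : IsFlow H false (cut graph S)
    S-flow = flow-cong refl w≗cut (bicycle⇒flow {w} w∈B)

    S-harmonic : Harmonic H S
    S-harmonic = mkHarmonic λ T _ _ → IsFlow.pairing≡ S-flow T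

-- Edge vectors and potentials on the four glued copies.

module _ (H : TwoTerminalGraph) where
  open TwoTerminalGraph H

  private
    Γ⁺ = TwoTerminalGraph.graph (glue H)

  restrict : Vector 𝔽₂ (1 + 4 * #E) → Fin 4 → Vector 𝔽₂ #E
  restrict w i e = w (suc (combine i e))

  join : 𝔽₂ → (Fin 4 → Vector 𝔽₂ #E) → Vector 𝔽₂ (1 + 4 * #E)
  join x w = x ∷ (λ e → uncurry w (remQuot #E e))

  restrict-join : ∀ x w i → restrict (join x w) i ≗ w i
  restrict-join x w i e = cong (uncurry w) (remQuot-combine i e)

  ≗-by-copies : ∀ {w w′} → w 0F ≡ w′ 0F → (∀ i → restrict w i ≗ restrict w′ i) → w ≗ w′
  ≗-by-copies eq₀ eq zero = eq₀
  ≗-by-copies {w} {w′} eq₀ eq (suc e) =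
    subst (λ e → w (suc e) ≡ w′ (suc e)) (combine-remQuot {4} #E e) (uncurry eq (remQuot {4} #E e))

  restrict-cut : ∀ S i → restrict (cut Γ⁺ S) i ≗ cut graph (S ∘ place i)
  restrict-cut S i e =
    cong (λ (j , e′) → cut graph (S ∘ place j) e′) (remQuot-combine {4} {#E} i e)

  pairing-glue : ∀ w T → pairing Γ⁺ w T ≡
    (w 0F ∧ (T 2F xor T 3F)) xor sum (λ i → pairing graph (restrict w i) (T ∘ place i))
  pairing-glue w T = cong ((w 0F ∧ (T 2F xor T 3F)) xor_)
    (trans (sum-combine 4 {#E} (λ e → w (suc e) ∧ cut Γ⁺ T (suc e)))
           (sum-cong-≗ (λ i → sum-cong-≗ (λ e → cong (restrict w i e ∧_) (restrict-cut T i e)))))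

  -- A flow sees a test function only through its values at the terminals. Each copy therefore acts
  -- as one edge of weight `s i`, and the pairing is computed on the five-edge bridge with vertices
  -- X, Y, a, b.
  pairing-glue-flows : ∀ (s : Vector 𝔽₂ 4) {w} → (∀ i → IsFlow H (s i) (restrict w i)) → ∀ T →
    pairing Γ⁺ w T ≡
    (w 0F ∧ (T 2F xor T 3F)) xor sum (λ i → s i ∧ (T (imageX {#inner} i) xor T (imageY {#inner} i)))
  pairing-glue-flows s {w} flows T =
    trans (pairing-glue w T) (cong ((w 0F ∧ (T 2F xor T 3F)) xor_)
      (sum-cong-≗ (λ i → IsFlow.pairing≡ (flows i) (T ∘ place i))))

  -- t lists the values at X, Y, a, b; of S i only the values at inner vertices are used.
  gluePotential : Vector 𝔽₂ 4 → (Fin 4 → Vector 𝔽₂ (2 + #inner)) → Vector 𝔽₂ (4 + 4 * #inner)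
  gluePotential t S 0F = t 0F
  gluePotential t S 1F = t 1F
  gluePotential t S 2F = t 2F
  gluePotential t S 3F = t 3F
  gluePotential t S (suc (suc (suc (suc v)))) = uncurry (λ i u → S i (2 ↑ʳ u)) (remQuot #inner v)

  -- imageX {0} and imageY {0} name the end of copy i as one of X, Y, a, b.
  gluePotential-place : ∀ t S →
    (∀ i → t (imageX {0} i) ≡ S i 0F) → (∀ i → t (imageY {0} i) ≡ S i 1F) →
    ∀ i → gluePotential t S ∘ place i ≗ S i
  gluePotential-place t S eqX eqY i (suc (suc u)) =
    cong (uncurry (λ i u → S i (2 ↑ʳ u))) (remQuot-combine {4} {#inner} i u)
  gluePotential-place t S eqX eqY 0F 0F = eqX 0F
  gluePotential-place t S eqX eqY 1F 0F = eqX 1F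
  gluePotential-place t S eqX eqY 2F 0F = eqX 2F
  gluePotential-place t S eqX eqY 3F 0F = eqX 3F
  gluePotential-place t S eqX eqY 0F 1F = eqY 0F
  gluePotential-place t S eqX eqY 1F 1F = eqY 1F
  gluePotential-place t S eqX eqY 2F 1F = eqY 2F
  gluePotential-place t S eqX eqY 3F 1F = eqY 3F

  -- A test function that vanishes at the terminals of copy `i` extends by zero to the whole glued
  -- graph, where the harmonicity of `S` applies.
  harmonic-place : ∀ {S} → Harmonic (glue H) S → ∀ i → Harmonic H (S ∘ place i)
  harmonic-place {S} harmonic i = mkHarmonic λ T TX TY →
    let
      E : Vector 𝔽₂ 4
      E j = pairing graph (cut graph (S ∘ place j)) T

      -- The indicator of `i` keeps `T` on copy `i` and kills it on the other copies.
      T′ : Fin 4 → Vector 𝔽₂ (2 + #inner)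
      T′ j v = T v ∧ does (j ≟ i)

      T⁺ : Vector 𝔽₂ (4 + 4 * #inner)
      T⁺ = gluePotential (const false) T′

      T⁺-place : ∀ j → T⁺ ∘ place j ≗ T′ j
      T⁺-place = gluePotential-place (const false) T′
        (λ j → cong (_∧ does (j ≟ i)) (sym TX)) (λ j → cong (_∧ does (j ≟ i)) (sym TY))
    in begin
    E i
      ≡⟨ sum-indicator E i ⟨
    sum (λ j → E j ∧ does (j ≟ i))
      ≡⟨ sum-cong-≗ (λ j → pairing-∧ʳ graph (does (j ≟ i)) (cut graph (S ∘ place j)) T) ⟨
    sum (λ j → pairing graph (cut graph (S ∘ place j)) (T′ j))
      ≡⟨ sum-cong-≗ (λ j → pairing-cong graph (restrict-cut S j) (T⁺-place j)) ⟨
    sum (λ j → pairing graph (restrict (cut Γ⁺ S) j) (T⁺ ∘ place j))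
      -- The new edge contributes nothing, since `T⁺` vanishes at a and b.
      ≡⟨ cong (_xor sum (λ j → pairing graph (restrict (cut Γ⁺ S) j) (T⁺ ∘ place j)))
              (∧-zeroʳ (cut Γ⁺ S 0F)) ⟨
    (cut Γ⁺ S 0F ∧ false) xor sum (λ j → pairing graph (restrict (cut Γ⁺ S) j) (T⁺ ∘ place j))
      ≡⟨ pairing-glue (cut Γ⁺ S) T⁺ ⟨
    pairing Γ⁺ (cut Γ⁺ S) T⁺
      ≡⟨ Harmonic.pairing≡0 harmonic T⁺ refl refl ⟩
    false ∎

-- Gluing preserves unit resistors.

module _ {H : TwoTerminalGraph} (R : IsUnitResistor H) where
  open TwoTerminalGraph H
  open IsUnitResistor R

  private
    Γ⁺ = TwoTerminalGraph.graph (glue H)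

    P : Vector 𝔽₂ #E
    P = cut graph potential

    δ : Fin (4 + 4 * #inner) → Vector 𝔽₂ (4 + 4 * #inner)
    δ v u = does (v ≟ u)

  drop : Vector 𝔽₂ (4 + 4 * #inner) → Vector 𝔽₂ 4
  drop S i = S (imageX {#inner} i) xor S (imageY {#inner} i)

  harmonic⇒flows : ∀ {S} → Harmonic (glue H) S →
                   ∀ i → IsFlow H (drop S i) (restrict H (cut Γ⁺ S) i)
  harmonic⇒flows {S} harmonic i =
    flow-cong refl (λ e → sym (restrict-cut H S i e))
              (harmonic⇒flow (S ∘ place i) (harmonic-place H harmonic i))

  pairing-harmonic : ∀ {S} → Harmonic (glue H) S → ∀ T → pairing Γ⁺ (cut Γ⁺ S) T ≡
    ((S 2F xor S 3F) ∧ (T 2F xor T 3F)) xor sum (λ i → drop S i ∧ drop T i)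
  pairing-harmonic {S} harmonic =
    pairing-glue-flows H (drop S) {cut Γ⁺ S} (harmonic⇒flows harmonic)

  -- The conservation law at a.
  balanced : ∀ {S} → Harmonic (glue H) S →
             (S 0F xor S 1F) xor (S 2F xor S 3F) ≡ false
  balanced {S} harmonic = begin
    (S 0F xor S 1F) xor (S 2F xor S 3F)
      ≡⟨ solve 4 (λ x y a b → (x :+ y) :+ (a :+ b) :=
           ((a :+ b) :* con true) :+ (((x :+ a) :* con true) :+ (((x :+ b) :* con false) :+
           (((a :+ y) :* con true) :+ (((b :+ y) :* con false) :+ con false)))))
           refl (S 0F) (S 1F) (S 2F) (S 3F) ⟩
    ((S 2F xor S 3F) ∧ (δ 2F 2F xor δ 2F 3F)) xor sum (λ i → drop S i ∧ drop (δ 2F) i)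
      ≡⟨ pairing-harmonic harmonic (δ 2F) ⟨
    pairing Γ⁺ (cut Γ⁺ S) (δ 2F)
      ≡⟨ Harmonic.pairing≡0 harmonic (δ 2F) refl refl ⟩
    false ∎

  -- The bridge is the complete graph on X, Y, a, b without the edge XY. Mod 2 the Laplacian of that
  -- complete graph is the all-ones matrix, so its form is a product of two sums over the four
  -- vertices. The factor coming from `S` is zero by `balanced`, which leaves the form of a single
  -- edge XY.
  glue-harmonic⇒flow : ∀ S → Harmonic (glue H) S → IsFlow (glue H) (S 0F xor S 1F) (cut Γ⁺ S)
  glue-harmonic⇒flow S harmonic = mkFlow λ T → begin
    pairing Γ⁺ (cut Γ⁺ S) T
      ≡⟨ pairing-harmonic harmonic T ⟩
    ((S 2F xor S 3F) ∧ (T 2F xor T 3F)) xor sum (λ i → drop S i ∧ drop T i)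
      ≡⟨ solve 8 (λ x y a b x′ y′ a′ b′ →
           ((a :+ b) :* (a′ :+ b′)) :+
             (((x :+ a) :* (x′ :+ a′)) :+ (((x :+ b) :* (x′ :+ b′)) :+
             (((a :+ y) :* (a′ :+ y′)) :+ (((b :+ y) :* (b′ :+ y′)) :+ con false))))
           := (((x :+ y) :+ (a :+ b)) :* ((x′ :+ y′) :+ (a′ :+ b′))) :+ ((x :+ y) :* (x′ :+ y′)))
           refl (S 0F) (S 1F) (S 2F) (S 3F) (T 0F) (T 1F) (T 2F) (T 3F) ⟩
    (((S 0F xor S 1F) xor (S 2F xor S 3F)) ∧ ((T 0F xor T 1F) xor (T 2F xor T 3F)))
      xor ((S 0F xor S 1F) ∧ (T 0F xor T 1F))
      ≡⟨ cong (λ k → (k ∧ ((T 0F xor T 1F) xor (T 2F xor T 3F))) xor ((S 0F xor S 1F) ∧ (T 0F xor T 1F)))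
              (balanced harmonic) ⟩
    (S 0F xor S 1F) ∧ (T 0F xor T 1F) ∎

  drop₄ : Vector 𝔽₂ 4 → Vector 𝔽₂ 4
  drop₄ t i = t (imageX {0} i) xor t (imageY {0} i)

  -- The potential with the ends of copy i prescribed by t, when each S i vanishes at X and Y.
  copyPotential : Vector 𝔽₂ 4 → (Fin 4 → Vector 𝔽₂ (2 + #inner)) → Fin 4 → Vector 𝔽₂ (2 + #inner)
  copyPotential t S i v = t (imageX {0} i) xor ((drop₄ t i ∧ potential v) xor S i v)

  interpolate : Vector 𝔽₂ 4 → (Fin 4 → Vector 𝔽₂ (2 + #inner)) → Vector 𝔽₂ (4 + 4 * #inner)
  interpolate t S = gluePotential H t (copyPotential t S)

  -- On copy `i` the potential is a constant plus a multiple of `potential` plus `S i`, and the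
  -- constant cancels in the cut. The vanishing of `S i` at X and Y makes the pieces agree at the
  -- glued vertices.
  restrict-cut-interpolate : ∀ t {S} → (∀ i → S i 0F ≡ false) → (∀ i → S i 1F ≡ false) →
    ∀ i → restrict H (cut Γ⁺ (interpolate t S)) i ≗ λ e → (drop₄ t i ∧ P e) xor cut graph (S i) e
  restrict-cut-interpolate t {S} SX SY i e = begin
    restrict H (cut Γ⁺ (interpolate t S)) i e
      ≡⟨ restrict-cut H (interpolate t S) i e ⟩
    cut graph (interpolate t S ∘ place i) e
      ≡⟨ cong₂ _xor_ (interpolate-place (proj₁ (ends e))) (interpolate-place (proj₂ (ends e))) ⟩
    cut graph (copyPotential t S i) e
      ≡⟨ solve 6 (λ x d p q r s →
           (x :+ ((d :* p) :+ r)) :+ (x :+ ((d :* q) :+ s)) := (d :* (p :+ q)) :+ (r :+ s))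
           refl (t (imageX {0} i)) (drop₄ t i)
           (potential (proj₁ (ends e))) (potential (proj₂ (ends e)))
           (S i (proj₁ (ends e))) (S i (proj₂ (ends e))) ⟩
    (drop₄ t i ∧ P e) xor cut graph (S i) e ∎
    where
    atX : ∀ i → t (imageX {0} i) ≡ copyPotential t S i 0F
    atX i rewrite potential-X | SX i =
      solve 2 (λ x y → x := x :+ (((x :+ y) :* con false) :+ con false))
        refl (t (imageX {0} i)) (t (imageY {0} i))

    atY : ∀ i → t (imageY {0} i) ≡ copyPotential t S i 1F
    atY i rewrite potential-Y | SY i =
      solve 2 (λ x y → y := x :+ (((x :+ y) :* con true) :+ con false))
        refl (t (imageX {0} i)) (t (imageY {0} i))

    interpolate-place : interpolate t S ∘ place i ≗ copyPotential t S i
    interpolate-place = gluePotential-place H t (copyPotential t S) atX atY i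

  interpolated-flow : ∀ x {w} → IsFlow H false w → IsFlow H x (λ e → (x ∧ P e) xor w e)
  interpolated-flow x flow =
    flow-cong (trans (xor-identityʳ (x ∧ true)) (∧-identityʳ x)) (λ _ → refl)
      (flow-+ (flow-∧ x unitFlow) flow)

  glue-isUnitResistor : IsUnitResistor (glue H)
  glue-isUnitResistor = record
    { harmonic⇒flow = glue-harmonic⇒flow
    ; potential     = interpolate t (λ _ _ → false)
    ; potential-X   = refl
    ; potential-Y   = refl
    ; unitFlow      = mkFlow λ T → trans
        (pairing-glue-flows H (drop₄ t) {cut Γ⁺ (interpolate t (λ _ _ → false))} flows T)
        (solve 4 (λ x y a b →
           (a :+ b) :+ ((con false :* (x :+ a)) :+ ((con true :* (x :+ b)) :+
             ((con true :* (a :+ y)) :+ ((con false :* (b :+ y)) :+ con false)))) := x :+ y)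
           refl (T 0F) (T 1F) (T 2F) (T 3F))
    }
    where
    -- X and a are at 0, Y and b at 1: the unit current runs from X through copy 2 to b, along the
    -- new edge to a, and through copy 3 to Y.
    t : Vector 𝔽₂ 4
    t = false ∷ true ∷ false ∷ true ∷ []

    flows : ∀ i → IsFlow H (drop₄ t i) (restrict H (cut Γ⁺ (interpolate t (λ _ _ → false))) i)
    flows i = flow-cong refl
      (λ e → sym (restrict-cut-interpolate t (λ _ → refl) (λ _ → refl) i e))
      (interpolated-flow (drop₄ t i) flow-0)

  -- The bicycles of the glued graph.

  glueBicycle : 𝔽₂ → (Fin 4 → Vector 𝔽₂ #E) → Vector 𝔽₂ (1 + 4 * #E)
  glueBicycle x w = join H false (λ i e → (x ∧ P e) xor w i e)

  restrict-glueBicycle : ∀ x w i → restrict H (glueBicycle x w) i ≗ λ e → (x ∧ P e) xor w i e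
  restrict-glueBicycle x w = restrict-join H false (λ i e → (x ∧ P e) xor w i e)

  -- Every copy carries a flow of strength `x`, and the copies form the 4-cycle X, a, Y, b, so all
  -- degrees are even. It is a cut because grounded potentials of the `w i` can be added to an
  -- interpolated one.
  glueBicycle-∈ : ∀ x {w} → (∀ i → w i ∈ bicycleSpace graph) → glueBicycle x w ∈ bicycleSpace Γ⁺
  glueBicycle-∈ x {w} w∈B = ⊥cut⇒cycle Γ⁺ {glueBicycle x w} even , interpolate t S , isCut
    where
    -- X and Y are at 0, a and b at `x`: every copy has drop `x` and the new edge has drop 0.
    t : Vector 𝔽₂ 4
    t = false ∷ false ∷ x ∷ x ∷ []

    drop₄-t : ∀ i → drop₄ t i ≡ x
    drop₄-t 0F = refl
    drop₄-t 1F = refl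
    drop₄-t 2F = xor-identityʳ x
    drop₄-t 3F = xor-identityʳ x

    grounded : ∀ i → ∃ λ S → S 0F ≡ false × S 1F ≡ false × w i ≗ cut graph S
    grounded i = bicycle-grounded R (w∈B i)

    S : Fin 4 → Vector 𝔽₂ (2 + #inner)
    S i = proj₁ (grounded i)

    isCut : glueBicycle x w ≗ cut Γ⁺ (interpolate t S)
    isCut = ≗-by-copies H (sym (xor-same x)) λ i e → trans (restrict-glueBicycle x w i e)
      (trans (cong₂ (λ y z → (y ∧ P e) xor z) (sym (drop₄-t i)) (proj₂ (proj₂ (proj₂ (grounded i))) e))
        (sym (restrict-cut-interpolate t {S} (λ i → proj₁ (proj₂ (grounded i)))
          (λ i → proj₁ (proj₂ (proj₂ (grounded i)))) i e)))

    flows : ∀ i → IsFlow H x (restrict H (glueBicycle x w) i)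
    flows i = flow-cong refl (λ e → sym (restrict-glueBicycle x w i e))
      (interpolated-flow x (bicycle⇒flow (w∈B i)))

    even : ∀ T → pairing Γ⁺ (glueBicycle x w) T ≡ false
    even T = trans (pairing-glue-flows H (const x) {glueBicycle x w} flows T)
      (solve 5 (λ x p q a b →
         (x :* (p :+ a)) :+ ((x :* (p :+ b)) :+ ((x :* (a :+ q)) :+ ((x :* (b :+ q)) :+ con false)))
         := con false)
         refl x (T 0F) (T 1F) (T 2F) (T 3F))

  -- The conservation laws force equal potentials at a and b and at X and Y, so all copies have the
  -- same drop `x`. Adding `x` times `P` on each copy leaves a cut that is a flow of strength zero,
  -- that is, a bicycle.
  bicycle-decomposes : ∀ {w} → w ∈ bicycleSpace Γ⁺ →
    ∃ λ x → ∃ λ w′ → (∀ i → w′ i ∈ bicycleSpace graph) × w ≗ glueBicycle x w′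
  bicycle-decomposes {w} w∈B⁺@(_ , S , w≗cut) = x , w′ , w′∈B , ≗-by-copies H w0 λ i e → begin
    restrict H w i e
      ≡⟨ solve 2 (λ p r → r := p :+ (p :+ r)) refl (x ∧ P e) (restrict H w i e) ⟩
    (x ∧ P e) xor w′ i e
      ≡⟨ restrict-glueBicycle x w′ i e ⟨
    restrict H (glueBicycle x w′) i e ∎
    where
    x : 𝔽₂
    x = S 0F xor S 2F

    w′ : Fin 4 → Vector 𝔽₂ #E
    w′ i e = (x ∧ P e) xor restrict H w i e

    S-flow : IsFlow (glue H) false (cut Γ⁺ S)
    S-flow = flow-cong refl w≗cut (bicycle⇒flow w∈B⁺)

    harmonic : Harmonic (glue H) S
    harmonic = mkHarmonic λ T _ _ → IsFlow.pairing≡ S-flow T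

    -- The conservation law at X, where copies 1 and 2 contribute `S 0F xor S 2F` and
    -- `S 0F xor S 3F`.
    a≡b : S 2F xor S 3F ≡ false
    a≡b = trans
      (solve 4 (λ x y a b → (a :+ b) :=
           ((a :+ b) :* con false) :+ (((x :+ a) :* con true) :+ (((x :+ b) :* con true) :+
           (((a :+ y) :* con false) :+ (((b :+ y) :* con false) :+ con false)))))
           refl (S 0F) (S 1F) (S 2F) (S 3F))
      (trans (sym (pairing-harmonic harmonic (δ 0F))) (IsFlow.pairing≡ S-flow (δ 0F)))

    X≡Y : S 0F xor S 1F ≡ false
    X≡Y = begin
      S 0F xor S 1F ≡⟨ xor-identityʳ (S 0F xor S 1F) ⟨
      (S 0F xor S 1F) xor false ≡⟨ cong ((S 0F xor S 1F) xor_) a≡b ⟨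
      (S 0F xor S 1F) xor (S 2F xor S 3F) ≡⟨ balanced harmonic ⟩
      false ∎

    w0 : w 0F ≡ false
    w0 = trans (w≗cut 0F) a≡b

    drop-S : ∀ i → (x xor drop S i) ≡ false
    drop-S 0F = xor-same x
    drop-S 1F = trans (solve 3 (λ x a b → (x :+ a) :+ (x :+ b) := a :+ b) refl (S 0F) (S 2F) (S 3F)) a≡b
    drop-S 2F = trans (solve 3 (λ x y a → (x :+ a) :+ (a :+ y) := x :+ y) refl (S 0F) (S 1F) (S 2F)) X≡Y
    drop-S 3F = trans
      (solve 4 (λ x y a b → (x :+ a) :+ (b :+ y) := (x :+ y) :+ (a :+ b)) refl (S 0F) (S 1F) (S 2F) (S 3F))
      (balanced harmonic)

    restrict≗cut : ∀ i → restrict H w i ≗ cut graph (S ∘ place i)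
    restrict≗cut i e = trans (w≗cut (suc (combine i e))) (restrict-cut H S i e)

    w′-flow : ∀ i → IsFlow H false (w′ i)
    w′-flow i = flow-cong
      (trans (cong (_xor drop S i) (∧-identityʳ x)) (drop-S i))
      (λ e → cong ((x ∧ P e) xor_) (sym (w≗cut (suc (combine i e)))))
      (flow-+ (flow-∧ x unitFlow) (harmonic⇒flows harmonic i))

    w′∈B : ∀ i → w′ i ∈ bicycleSpace graph
    w′∈B i = ⊥cut⇒cycle graph {w′ i} (IsFlow.pairing≡ (w′-flow i)) ,
      (λ v → (x ∧ potential v) xor S (place i v)) , λ e → trans (cong ((x ∧ P e) xor_) (restrict≗cut i e))
        (solve 5 (λ x p q r s → (x :* (p :+ q)) :+ (r :+ s) := ((x :* p) :+ r) :+ ((x :* q) :+ s))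
          refl x (potential (proj₁ (ends e))) (potential (proj₂ (ends e)))
          (S (place i (proj₁ (ends e)))) (S (place i (proj₂ (ends e)))))

  -- P is not a bicycle, for it has odd degree at X.
  glueBicycle-injective : ∀ {x w} → (∀ i → w i ∈ bicycleSpace graph) →
    glueBicycle x w ≗ const false → x ≡ false × (∀ i → w i ≗ const false)
  glueBicycle-injective {x} {w} w∈B ≗0 = x≡false , λ i e → begin
    w i e                  ≡⟨ cong (λ x → (x ∧ P e) xor w i e) x≡false ⟨
    (x ∧ P e) xor w i e    ≡⟨ copy≗0 i e ⟩
    false                  ∎
    where
    copy≗0 : ∀ i e → (x ∧ P e) xor w i e ≡ false
    copy≗0 i e = trans (sym (restrict-glueBicycle x w i e)) (≗0 (suc (combine i e)))

    x≡false : x ≡ false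
    x≡false = flow-unique
      (flow-cong refl (copy≗0 0F) (interpolated-flow x (bicycle⇒flow (w∈B 0F))))
      flow-0

  glueBicycle-cong : ∀ x {w w′} → (∀ i → w i ≗ w′ i) → glueBicycle x w ≗ glueBicycle x w′
  glueBicycle-cong x w≗w′ zero    = refl
  glueBicycle-cong x w≗w′ (suc e) =
    uncurry (λ i e → cong ((x ∧ P e) xor_) (w≗w′ i e)) (remQuot {4} #E e)

  -- A basis of the bicycle space of the glued graph.

  module _ {k : ℕ} (b : Vector (Vector 𝔽₂ #E) k) where

    copyBasis : Fin 4 → Fin k → Vector 𝔽₂ (1 + 4 * #E)
    copyBasis i j = glueBicycle false (λ i′ e → does (i ≟ i′) ∧ b j e)

    glueBasis : Vector (Vector 𝔽₂ (1 + 4 * #E)) (1 + 4 * k)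
    glueBasis = glueBicycle true (λ _ _ → false) ∷ (λ j → uncurry copyBasis (remQuot k j))

    coefficients : Vector 𝔽₂ (1 + 4 * k) → Fin 4 → Vector 𝔽₂ k
    coefficients c i j = c (suc (combine i j))

    -- Coefficients for `glueBasis` amount to a scalar and four coefficient vectors for `b`, on
    -- which `glueBicycle` depends linearly. Independence and spanning are thereby reduced to those
    -- of `b`.
    linearCombination-glueBasis : ∀ c → linearCombination c glueBasis ≗
      glueBicycle (c 0F) (λ i → linearCombination (coefficients c i) b)
    linearCombination-glueBasis c = ≗-by-copies H
      (cong₂ _xor_ (∧-zeroʳ (c 0F)) (sum-zero (λ j → ∧-zeroʳ (c (suc j)))))
      λ i e → begin
        (c 0F ∧ restrict H (glueBasis 0F) i e) xor
          sum (λ j → c (suc j) ∧ restrict H (glueBasis (suc j)) i e)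
          ≡⟨ cong₂ _xor_
               (cong (c 0F ∧_)
                 (trans (restrict-glueBicycle true (λ _ _ → false) i e) (xor-identityʳ (P e))))
               (copies i e) ⟩
        (c 0F ∧ P e) xor linearCombination (coefficients c i) b e
          ≡⟨ restrict-glueBicycle (c 0F) (λ i → linearCombination (coefficients c i) b) i e ⟨
        restrict H (glueBicycle (c 0F) (λ i → linearCombination (coefficients c i) b)) i e ∎
      where
      copies : ∀ i e → sum (λ j → c (suc j) ∧ restrict H (glueBasis (suc j)) i e) ≡
               linearCombination (coefficients c i) b e
      copies i e = begin
        sum (λ j → c (suc j) ∧ restrict H (glueBasis (suc j)) i e)
          ≡⟨ sum-combine 4 {k} (λ j → c (suc j) ∧ restrict H (glueBasis (suc j)) i e) ⟩
        sum (λ i′ → sum (λ j → coefficients c i′ j ∧ restrict H (glueBasis (suc (combine i′ j))) i e))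
          ≡⟨ sum-cong-≗ (λ i′ → trans (sum-cong-≗ (term i′))
               (sym (*-distribʳ-sum (does (i′ ≟ i)) (λ j → coefficients c i′ j ∧ b j e)))) ⟩
        sum (λ i′ → linearCombination (coefficients c i′) b e ∧ does (i′ ≟ i))
          ≡⟨ sum-indicator (λ i′ → linearCombination (coefficients c i′) b e) i ⟩
        linearCombination (coefficients c i) b e ∎
        where
        term : ∀ i′ j → coefficients c i′ j ∧ restrict H (glueBasis (suc (combine i′ j))) i e ≡
               (coefficients c i′ j ∧ b j e) ∧ does (i′ ≟ i)
        term i′ j = begin
          coefficients c i′ j ∧ restrict H (glueBasis (suc (combine i′ j))) i e
            ≡⟨ cong (λ p → coefficients c i′ j ∧ restrict H (uncurry copyBasis p) i e)
                    (remQuot-combine {4} {k} i′ j) ⟩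
          coefficients c i′ j ∧ restrict H (copyBasis i′ j) i e
            ≡⟨ cong (coefficients c i′ j ∧_)
                    (restrict-glueBicycle false (λ i″ e → does (i′ ≟ i″) ∧ b j e) i e) ⟩
          coefficients c i′ j ∧ (does (i′ ≟ i) ∧ b j e)
            ≡⟨ solve 3 (λ x y z → x :* (y :* z) := (x :* z) :* y) refl
                 (coefficients c i′ j) (does (i′ ≟ i)) (b j e) ⟩
          (coefficients c i′ j ∧ b j e) ∧ does (i′ ≟ i) ∎

    glue-isBasis : IsBasis (bicycleSpace graph) b → IsBasis (bicycleSpace Γ⁺) glueBasis
    glue-isBasis B = record
      { members     = λ where
          zero    → glueBicycle-∈ true {λ _ _ → false} (λ _ → Subspace.0-closed (bicycleSpace graph))
          (suc j) → uncurry copyBasis-∈ (remQuot {4} k j)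
      ; independent = independent′
      ; spanning    = spanning′
      }
      where
      open IsBasis B

      scaled : ∀ x j → (λ e → x ∧ b j e) ∈ bicycleSpace graph
      scaled false j = Subspace.0-closed (bicycleSpace graph)
      scaled true  j = members j

      copyBasis-∈ : ∀ i j → copyBasis i j ∈ bicycleSpace Γ⁺
      copyBasis-∈ i j = glueBicycle-∈ false {λ i′ e → does (i ≟ i′) ∧ b j e}
        (λ i′ → scaled (does (i ≟ i′)) j)

      independent′ : ∀ c → linearCombination c glueBasis ≗ const false → c ≗ const false
      independent′ c ≗0 = λ where
          zero    → proj₁ zeros
          (suc j) → trans (cong (c ∘ suc) (sym (combine-remQuot {4} k j)))
                          (uncurry (λ i → independent (coefficients c i) (proj₂ zeros i))
                                   (remQuot {4} k j))
        where
        zeros : c 0F ≡ false × (∀ i → linearCombination (coefficients c i) b ≗ const false)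
        zeros = glueBicycle-injective {c 0F} {λ i → linearCombination (coefficients c i) b}
          (λ i → linearCombination-∈ (bicycleSpace graph) members (coefficients c i))
          (λ e → trans (sym (linearCombination-glueBasis c e)) (≗0 e))

      spanned : ∀ x w′ → (∀ i → w′ i ∈ bicycleSpace graph) →
                ∃ λ c → glueBicycle x w′ ≗ linearCombination c glueBasis
      spanned x w′ w′∈B = c⁺ , λ e → trans
        (glueBicycle-cong x {w′} {λ i → linearCombination (coefficients c⁺ i) b} w′≗ e)
        (sym (linearCombination-glueBasis c⁺ e))
        where
        c : Fin 4 → Vector 𝔽₂ k
        c i = proj₁ (spanning (w′ i) (w′∈B i))

        c⁺ : Vector 𝔽₂ (1 + 4 * k)
        c⁺ = x ∷ (λ j → uncurry c (remQuot k j))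

        w′≗ : ∀ i → w′ i ≗ linearCombination (coefficients c⁺ i) b
        w′≗ i e = begin
          w′ i e
            ≡⟨ proj₂ (spanning (w′ i) (w′∈B i)) e ⟩
          sum (λ j → c i j ∧ b j e)
            ≡⟨ sum-cong-≗ {x = λ j → c i j ∧ b j e} {y = λ j → coefficients c⁺ i j ∧ b j e}
                 (λ j → cong (λ p → uncurry c p ∧ b j e) (sym (remQuot-combine {4} {k} i j))) ⟩
          sum (λ j → coefficients c⁺ i j ∧ b j e) ∎

      spanning′ : ∀ w → w ∈ bicycleSpace Γ⁺ → ∃ λ c → w ≗ linearCombination c glueBasis
      spanning′ w w∈B⁺ =
        let x , w′ , w′∈B , w≗ = bicycle-decomposes {w} w∈B⁺
            c , ≗c             = spanned x w′ w′∈B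
        in c , λ e → trans (w≗ e) (≗c e)

  glue-bicycleDimension : ∀ {d} → HasBicycleDimension graph d → HasBicycleDimension Γ⁺ (1 + 4 * d)
  glue-bicycleDimension (mkHasBicycleDimension (b , isBasis)) =
    mkHasBicycleDimension (glueBasis b , glue-isBasis b isBasis)

-- The base case, the induction and the closed formula.

K₂-isUnitResistor : IsUnitResistor K₂
K₂-isUnitResistor = record
  { harmonic⇒flow = λ S _ → mkFlow λ T → xor-identityʳ ((S 0F xor S 1F) ∧ (T 0F xor T 1F))
  ; potential     = false ∷ true ∷ []
  ; potential-X   = refl
  ; potential-Y   = refl
  ; unitFlow      = mkFlow λ T → xor-identityʳ (T 0F xor T 1F)
  }

-- The degree at X is the value on the only edge, so evenness makes every bicycle zero.
K₂-bicycleDimension : HasBicycleDimension (G 0) 0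
K₂-bicycleDimension = mkHasBicycleDimension ([] , record
  { members     = λ ()
  ; independent = λ _ _ ()
  ; spanning    = λ w (even , _) → [] , λ where
      zero → trans (sym (trans (xor-identityʳ (w 0F ∧ true)) (∧-identityʳ (w 0F)))) (even 0F)
  })

G-isUnitResistor : ∀ n → IsUnitResistor (twoTerminalG n)
G-isUnitResistor zero    = K₂-isUnitResistor
G-isUnitResistor (suc n) = glue-isUnitResistor (G-isUnitResistor n)

bicycleDimension : ℕ → ℕ
bicycleDimension zero    = 0
bicycleDimension (suc n) = 1 + 4 * bicycleDimension n

G-bicycleDimension : ∀ n → HasBicycleDimension (G n) (bicycleDimension n)
G-bicycleDimension zero    = K₂-bicycleDimension
G-bicycleDimension (suc n) = glue-bicycleDimension (G-isUnitResistor n) (G-bicycleDimension n)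

-- The geometric sum in a form free of truncated subtraction and division, suited to induction.
bicycleDimension-closed : ∀ n → 1 + bicycleDimension n * 3 ≡ 4 ^ n
bicycleDimension-closed zero    = refl
bicycleDimension-closed (suc n) =
  trans (expand (bicycleDimension n)) (cong (4 *_) (bicycleDimension-closed n))
  where
  expand : ∀ d → 1 + (1 + 4 * d) * 3 ≡ 4 * (1 + d * 3)
  expand = solve-∀

corollary6 : (n : ℕ) → HasDimension (bicycleSpace (G n)) ((4 ^ n ∸ 1) / 3)
corollary6 n = subst (HasDimension (bicycleSpace (G n))) dimension hasDimension
  where
  open HasBicycleDimension (G-bicycleDimension n)

  dimension : bicycleDimension n ≡ (4 ^ n ∸ 1) / 3
  dimension = begin
    bicycleDimension n                   ≡⟨ m*n/n≡m (bicycleDimension n) 3 ⟨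
    (1 + bicycleDimension n * 3 ∸ 1) / 3 ≡⟨ cong (λ k → (k ∸ 1) / 3) (bicycleDimension-closed n) ⟩
    (4 ^ n ∸ 1) / 3                      ∎
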